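{- There exists a functor $K^*_{\mathbf{mbC}}:\mathbf{BAlg}\to\mathbf{SW}_{\mathbf{mbC}}$ given by $K^*_{\mathbf{mbC}}(\mathcal{A})=\mathcal{B}_{\mathcal{A}}^{\mathbf{mbC}}$ for every Boolean algebra $\mathcal{A}$, and $K^*_{\mathbf{mbC}}(f)=f_\ast$ for every homomorphism $f:\mathcal{A}\to\mathcal{A}'$ of Boolean algebras, where $f_\ast(z_1,z_2,z_3)=(f(z_1),f(z_2),f(z_3))$.
   Context: Let $\Sigma=\{\wedge,\vee,\to,\neg,\circ\}$, with $\wedge,\vee,\to$ binary and $\neg,\circ$ unary. A multialgebra over $\Sigma$ is a nonempty set $B$ with, for each $n$-ary symbol $c$, a function $c^{\mathcal{B}}:B^n\to\wp(B)\setminus\{\emptyset\}$. A homomorphism $f:\mathcal{A}\to\mathcal{B}$ is a function between the domains with $f[c^{\mathcal{A}}(\vec a)]\subseteq c^{\mathcal{B}}(f(\vec a))$ for all $c$ and $\vec a$. These form the category $\mathbf{MAlg}(\Sigma)$. $\mathbf{BAlg}$ is the category of Boolean algebras and Boolean homomorphisms (the one-element Boolean algebra is allowed). For a Boolean algebra $\mathcal{A}$ with domain $A$ and $z\in A^3$ write $z=(z_1,z_2,z_3)$. Put $\mathrm{B}_{\mathcal{A}}^{\mathbf{mbC}}=\{z\in A^3 : z_1\vee z_2=1 \text{ and } z_1\wedge z_2\wedge z_3=0\}$. A swap structure for $\mathbf{mbC}$ over $\mathcal{A}$ is a multialgebra $\mathcal{B}$ over $\Sigma$ with domain $B\subseteq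 \mathrm{B}_{\mathcal{A}}^{\mathbf{mbC}}$ such that $0\in\{z_1: z\in B\}$ and for all $z,w\in B$: (i) $\emptyset\ne z\#w\subseteq\{u\in B: u_1=z_1\# w_1\}$ for $\#\in\{\wedge,\vee,\to\}$; (ii) $\emptyset\neq\neg z\subseteq\{u\in B:u_1=z_2\}$; (iii) $\emptyset\ne\circ z\subseteq\{u\in B:u_1=z_3\}$. The full swap structure $\mathcal{B}_{\mathcal{A}}^{\mathbf{mbC}}$ has domain $\mathrm{B}_{\mathcal{A}}^{\mathbf{mbC}}$ and equality in the right-hand inclusions of (i)–(iii). $\mathbf{SW}_{\mathbf{mbC}}$ is the full subcategory of $\mathbf{MAlg}(\Sigma)$ whose objects are the swap structures for $\mathbf{mbC}$ (over arbitrary Boolean algebras). -}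

module Defs where

open import Algebra.Lattice.Bundles using (BooleanAlgebra)
open import Algebra.Lattice.Morphism.Structures using (IsLatticeHomomorphism)
import Algebra.Lattice.Morphism.Construct.Identity as LatticeId
import Algebra.Lattice.Morphism.Construct.Composition as LatticeComp
open import Data.Nat.Base using (ℕ)
open import Data.Product.Base using (Σ; Σ-syntax; ∃; _×_; _,_; proj₁; proj₂)
open import Data.Product.Relation.Binary.Pointwise.NonDependent using (×-setoid)
open import Data.Vec.Base using (Vec; []; _∷_; map)
open import Data.Vec.Properties using (map-id; map-∘)
open import Data.Vec.Relation.Binary.Pointwise.Inductive using (Pointwise)
open import Function.Base using (id; _∘_)
open import Function.Bundles using (Func)
import Function.Construct.Identity as FuncId
import Function.Construct.Composition as FuncComp
open import Level using (Level; suc; _⊔_)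
open import Relation.Binary.Bundles using (Setoid)
open import Relation.Binary.Core using (Rel)
import Relation.Binary.Construct.On as On
open import Relation.Binary.PropositionalEquality using (subst; sym)
open import Relation.Binary.Structures using (IsEquivalence)
open import Relation.Unary using (Pred; _∈_; _⊆_; Satisfiable)

private
  variable
    o o′ h h′ e e′ a c ℓ p : Level

-- Hom-sets carry an explicit equality of morphisms.
record Category o h e : Set (suc (o ⊔ h ⊔ e)) where
  infix  4 _≈_
  infixr 9 _∙_
  field
    Obj       : Set o
    Hom       : Obj → Obj → Set h
    _≈_       : ∀ {A B} → Rel (Hom A B) e
    identity  : ∀ {A} → Hom A A
    _∙_       : ∀ {A B C} → Hom B C → Hom A B → Hom A C
    equiv     : ∀ {A B} → IsEquivalence (_≈_ {A} {B})
    ∙-cong    : ∀ {A B C} {f f′ : Hom B C} {g g′ : Hom A B} →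
                f ≈ f′ → g ≈ g′ → f ∙ g ≈ f′ ∙ g′
    identityˡ : ∀ {A B} (f : Hom A B) → identity ∙ f ≈ f
    identityʳ : ∀ {A B} (f : Hom A B) → f ∙ identity ≈ f
    assoc     : ∀ {A B C D} (f : Hom C D) (g : Hom B C) (k : Hom A B) →
                (f ∙ g) ∙ k ≈ f ∙ (g ∙ k)

record IsFunctor (C : Category o h e) (D : Category o′ h′ e′)
                 (F₀ : Category.Obj C → Category.Obj D)
                 (F₁ : ∀ {A B} → Category.Hom C A B →
                       Category.Hom D (F₀ A) (F₀ B))
                 : Set (o ⊔ h ⊔ e ⊔ e′) where
  private
    module C = Category C
    module D = Category D
  field
    cong     : ∀ {A B} {f g : C.Hom A B} → f C.≈ g → F₁ f D.≈ F₁ g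
    identity : ∀ {A} → F₁ (C.identity {A}) D.≈ D.identity
    homo     : ∀ {A B C} (g : C.Hom B C) (f : C.Hom A B) →
               F₁ (g C.∙ f) D.≈ F₁ g D.∙ F₁ f

-- The subcategory is given by a family of objects of C, so that an object
-- may carry more data than its image in C.
FullSubcategory : (C : Category o h e) {I : Set a} →
                  (I → Category.Obj C) → Category a h e
FullSubcategory C {I} U = record
  { Obj       = I
  ; Hom       = λ i j → Hom (U i) (U j)
  ; _≈_       = _≈_
  ; identity  = identity
  ; _∙_       = _∙_
  ; equiv     = equiv
  ; ∙-cong    = ∙-cong
  ; identityˡ = identityˡ
  ; identityʳ = identityʳ
  ; assoc     = assoc
  } where open Category C

record BooleanHom (A B : BooleanAlgebra c ℓ) : Set (c ⊔ ℓ) where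
  private
    module A = BooleanAlgebra A
    module B = BooleanAlgebra B
  field
    ⟦_⟧                   : A.Carrier → B.Carrier
    isLatticeHomomorphism : IsLatticeHomomorphism A.rawLattice B.rawLattice ⟦_⟧
    ¬-homo                : ∀ x → ⟦ A.¬ x ⟧ B.≈ B.¬ ⟦ x ⟧
    ⊤-homo                : ⟦ A.⊤ ⟧ B.≈ B.⊤
    ⊥-homo                : ⟦ A.⊥ ⟧ B.≈ B.⊥

  open IsLatticeHomomorphism isLatticeHomomorphism public

BAlg : ∀ c ℓ → Category (suc (c ⊔ ℓ)) (c ⊔ ℓ) (c ⊔ ℓ)
BAlg c ℓ = record
  { Obj       = BooleanAlgebra c ℓ
  ; Hom       = BooleanHom
  ; _≈_       = λ {_} {B} f g → let open BooleanAlgebra B in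
                  ∀ x → ⟦ f ⟧ x ≈ ⟦ g ⟧ x
  ; identity  = λ {A} → let open BooleanAlgebra A in record
      { ⟦_⟧                   = id
      ; isLatticeHomomorphism = LatticeId.isLatticeHomomorphism rawLattice refl
      ; ¬-homo                = λ _ → refl
      ; ⊤-homo                = refl
      ; ⊥-homo                = refl
      }
  ; _∙_       = λ {_} {_} {C} g f → let open BooleanAlgebra C in record
      { ⟦_⟧                   = ⟦ g ⟧ ∘ ⟦ f ⟧
      ; isLatticeHomomorphism = LatticeComp.isLatticeHomomorphism trans
          (isLatticeHomomorphism f) (isLatticeHomomorphism g)
      ; ¬-homo                = λ x → trans (⟦⟧-cong g (¬-homo f x))
                                            (¬-homo g (⟦ f ⟧ x))
      ; ⊤-homo                = trans (⟦⟧-cong g (⊤-homo f)) (⊤-homo g)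
      ; ⊥-homo                = trans (⟦⟧-cong g (⊥-homo f)) (⊥-homo g)
      }
  ; equiv     = λ {_} {B} → let open BooleanAlgebra B in record
      { refl  = λ _ → refl
      ; sym   = λ f≈g x → BooleanAlgebra.sym B (f≈g x)
      ; trans = λ f≈g g≈k x → trans (f≈g x) (g≈k x)
      }
  ; ∙-cong    = λ {_} {_} {C} {f} {_} {_} {g′} f≈f′ g≈g′ x →
                  BooleanAlgebra.trans C (⟦⟧-cong f (g≈g′ x)) (f≈f′ (⟦ g′ ⟧ x))
  ; identityˡ = λ {_} {B} _ _ → BooleanAlgebra.refl B
  ; identityʳ = λ {_} {B} _ _ → BooleanAlgebra.refl B
  ; assoc     = λ {_} {_} {_} {D} _ _ _ _ → BooleanAlgebra.refl D
  } where open BooleanHom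

data Symbol : ℕ → Set where
  ‵∧ ‵∨ ‵→ : Symbol 2
  ‵¬ ‵∘    : Symbol 1

-- A carrier with a map assigning to each n-ary symbol and each n-tuple a
-- (possibly empty) subset of the carrier.
record RawMultialgebra a ℓ p : Set (suc (a ⊔ ℓ ⊔ p)) where
  field
    setoid : Setoid a ℓ
  open Setoid setoid public using (Carrier; _≈_)
  field
    op : ∀ {n} → Symbol n → Vec Carrier n → Pred Carrier p

-- Since equality on the carrier is a setoid equality, op-resp says that op is
-- a well-defined function whose values are well-defined subsets.
record IsMultialgebra (M : RawMultialgebra a ℓ p) : Set (a ⊔ ℓ ⊔ p) where
  open RawMultialgebra M
  field
    nonempty    : Carrier
    op-nonempty : ∀ {n} (s : Symbol n) xs → Satisfiable (op s xs)
    op-resp     : ∀ {n} (s : Symbol n) {xs ys x y} → Pointwise _≈_ xs ys →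
                  x ≈ y → x ∈ op s xs → y ∈ op s ys

record Multialgebra a ℓ p : Set (suc (a ⊔ ℓ ⊔ p)) where
  field
    raw            : RawMultialgebra a ℓ p
    isMultialgebra : IsMultialgebra raw
  open RawMultialgebra raw public
  open IsMultialgebra isMultialgebra public

record MultialgebraHom (M N : Multialgebra a ℓ p) : Set (a ⊔ ℓ ⊔ p) where
  private
    module M = Multialgebra M
    module N = Multialgebra N
  field
    func : Func M.setoid N.setoid
  open Func func public
  field
    preserves : ∀ {n} (s : Symbol n) (xs : Vec M.Carrier n) {x} →
                x ∈ M.op s xs → to x ∈ N.op s (map to xs)

MAlg : ∀ a ℓ p → Category (suc (a ⊔ ℓ ⊔ p)) (a ⊔ ℓ ⊔ p) (a ⊔ ℓ)
MAlg a ℓ p = record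
  { Obj       = Multialgebra a ℓ p
  ; Hom       = MultialgebraHom
  ; _≈_       = λ {_} {N} f g → let open Multialgebra N in
                  ∀ x → to f x ≈ to g x
  ; identity  = λ {M} → let open Multialgebra M in record
      { func      = FuncId.function setoid
      ; preserves = λ s xs {x} x∈ →
          subst (λ ys → x ∈ op s ys) (sym (map-id xs)) x∈
      }
  ; _∙_       = λ {_} {_} {P} g f → let open Multialgebra P in record
      { func      = FuncComp.function (func f) (func g)
      ; preserves = λ s xs {x} x∈ →
          subst (λ ys → to g (to f x) ∈ op s ys)
                (sym (map-∘ (to g) (to f) xs))
                (preserves g s (map (to f) xs) (preserves f s xs x∈))
      }
  ; equiv     = λ {_} {N} → let module N = Setoid (Multialgebra.setoid N) in record
      { refl  = λ _ → N.refl
      ; sym   = λ f≈g x → N.sym (f≈g x)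
      ; trans = λ f≈g g≈k x → N.trans (f≈g x) (g≈k x)
      }
  ; ∙-cong    = λ {_} {_} {P} {f} {_} {_} {g′} f≈f′ g≈g′ x →
                  Setoid.trans (Multialgebra.setoid P)
                    (cong f (g≈g′ x)) (f≈f′ (to g′ x))
  ; identityˡ = λ {_} {N} _ _ → Setoid.refl (Multialgebra.setoid N)
  ; identityʳ = λ {_} {N} _ _ → Setoid.refl (Multialgebra.setoid N)
  ; assoc     = λ {_} {_} {_} {Q} _ _ _ _ → Setoid.refl (Multialgebra.setoid Q)
  } where open MultialgebraHom

module _ (A : BooleanAlgebra c ℓ) where
  open BooleanAlgebra A

  Triple : Set c
  Triple = Carrier × Carrier × Carrier

  tripleSetoid : Setoid c ℓ
  tripleSetoid = ×-setoid setoid (×-setoid setoid setoid)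

  B-mbC : Pred Triple ℓ
  B-mbC (z₁ , z₂ , z₃) = z₁ ∨ z₂ ≈ ⊤ × z₁ ∧ z₂ ∧ z₃ ≈ ⊥

  -- A subset of A³ with multioperations on it, not yet subject to any laws.
  record RawSwapStructure : Set (suc (c ⊔ ℓ)) where
    field
      dom : Pred Triple ℓ
      op  : ∀ {n} → Symbol n → Vec (∃ dom) n → Pred (∃ dom) ℓ

    -- Elements of dom are compared as triples, ignoring membership proofs.
    rawMultialgebra : RawMultialgebra (c ⊔ ℓ) ℓ ℓ
    rawMultialgebra = record
      { setoid = On.setoid tripleSetoid (proj₁ {B = dom})
      ; op     = op
      }

  -- The first coordinate prescribed for the elements of s(zs):
  -- z₁ # w₁ for binary #, z₂ for ¬ z and z₃ for ∘ z.
  target : ∀ {n} {D : Pred Triple ℓ} → Symbol n → Vec (∃ D) n → Carrier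
  target ‵∧ (((z₁ , _) , _) ∷ ((w₁ , _) , _) ∷ []) = z₁ ∧ w₁
  target ‵∨ (((z₁ , _) , _) ∷ ((w₁ , _) , _) ∷ []) = z₁ ∨ w₁
  target ‵→ (((z₁ , _) , _) ∷ ((w₁ , _) , _) ∷ []) = ¬ z₁ ∨ w₁
  target ‵¬ (((_ , z₂ , _) , _) ∷ [])              = z₂
  target ‵∘ (((_ , _ , z₃) , _) ∷ [])              = z₃

  -- Nonemptiness of the values of op is part of isMultialgebra.
  record IsSwapStructure (S : RawSwapStructure) : Set (c ⊔ ℓ) where
    open RawSwapStructure S
    field
      isMultialgebra : IsMultialgebra rawMultialgebra
      dom-resp       : ∀ {z w} → Setoid._≈_ tripleSetoid z w → z ∈ dom → w ∈ dom
      dom⊆B          : dom ⊆ B-mbC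
      0∈dom₁         : Σ[ z ∈ Triple ] (z ∈ dom × proj₁ z ≈ ⊥)
      op⊆            : ∀ {n} (s : Symbol n) zs →
                       op s zs ⊆ (λ u → proj₁ (proj₁ u) ≈ target s zs)

  fullSwapStructure : RawSwapStructure
  fullSwapStructure = record
    { dom = B-mbC
    ; op  = λ s zs u → proj₁ (proj₁ u) ≈ target s zs
    }

record SwapStructure c ℓ : Set (suc (c ⊔ ℓ)) where
  constructor swapStructure
  field
    algebra         : BooleanAlgebra c ℓ
    raw             : RawSwapStructure algebra
    isSwapStructure : IsSwapStructure algebra raw

  multialgebra : Multialgebra (c ⊔ ℓ) ℓ ℓ
  multialgebra = record
    { raw            = RawSwapStructure.rawMultialgebra raw
    ; isMultialgebra = IsSwapStructure.isMultialgebra isSwapStructure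
    }

SW-mbC : ∀ c ℓ → Category (suc (c ⊔ ℓ)) (c ⊔ ℓ) (c ⊔ ℓ)
SW-mbC c ℓ = FullSubcategory (MAlg (c ⊔ ℓ) ℓ ℓ)
                             (SwapStructure.multialgebra {c} {ℓ})

_⁎ : {A B : BooleanAlgebra c ℓ} → BooleanHom A B → Triple A → Triple B
(f ⁎) (z₁ , z₂ , z₃) = ⟦ z₁ ⟧ , ⟦ z₂ ⟧ , ⟦ z₃ ⟧
  where open BooleanHom f

{-# OPTIONS --safe #-}
module Submission where

open import Defs
open import Algebra.Lattice.Bundles using (BooleanAlgebra)
open import Algebra.Lattice.Morphism.Structures using (IsLatticeHomomorphism)
import Algebra.Lattice.Properties.BooleanAlgebra as BooleanAlgebraProperties
open import Data.Product.Base using (Σ-syntax; _×_; _,_; proj₁; proj₂; ∃)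
open import Data.Vec.Base using (Vec; []; _∷_; map)
open import Data.Vec.Relation.Binary.Pointwise.Inductive using (Pointwise; []; _∷_)
open import Level using (Level)
open import Relation.Binary.Bundles using (Setoid)
import Relation.Binary.Construct.On as On
open import Relation.Unary using (Pred; _∈_)

-- In the full swap structure everything is equational. Membership in `B-mbC` is two Boolean
-- equations, and `u` lies in the value of a symbol exactly when the first coordinate of `u` equals
-- `target`, which is a Boolean term in the arguments' coordinates. Values are nonempty because
-- every `t` is the first coordinate of the triple `(t , ¬ t , ⊥)` of `B-mbC`. A Boolean
-- homomorphism preserves such equations and commutes with such terms, so applying it coordinatewise
-- maps domain to domain (`⁎-B-mbC`) and values into values (`target-homo`). The functor laws are
-- then read off coordinatewise.

private
  variable
    c ℓ : Level

module _ (A : BooleanAlgebra c ℓ) where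
  open BooleanAlgebra A
  open BooleanAlgebraProperties A using (∧-zeroʳ)

  -- Every first coordinate is realised in B-mbC, so no value of an operation is empty.
  canonical : Carrier → ∃ (B-mbC A)
  canonical t = (t , ¬ t , ⊥)
              , ∨-complementʳ t , trans (∧-congˡ (∧-zeroʳ (¬ t))) (∧-zeroʳ t)

  B-mbC-resp : ∀ {z w} → Setoid._≈_ (tripleSetoid A) z w → z ∈ B-mbC A → w ∈ B-mbC A
  B-mbC-resp (p , q , r) (z∨ , z∧) =
      trans (sym (∨-cong p q)) z∨
    , trans (sym (∧-cong p (∧-cong q r))) z∧

  target-cong : ∀ {n} {D : Pred (Triple A) ℓ} (s : Symbol n) {xs ys : Vec (∃ D) n} →
                Pointwise (Setoid._≈_ (On.setoid (tripleSetoid A) (proj₁ {B = D}))) xs ys →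
                target A s xs ≈ target A s ys
  target-cong ‵∧ ((p , _) ∷ (q , _) ∷ []) = ∧-cong p q
  target-cong ‵∨ ((p , _) ∷ (q , _) ∷ []) = ∨-cong p q
  target-cong ‵→ ((p , _) ∷ (q , _) ∷ []) = ∨-cong (¬-cong p) q
  target-cong ‵¬ ((_ , p , _) ∷ [])       = p
  target-cong ‵∘ ((_ , _ , p) ∷ [])       = p

  fullSwapStructure-isSwapStructure : IsSwapStructure A (fullSwapStructure A)
  fullSwapStructure-isSwapStructure = record
    { isMultialgebra = record
      { nonempty    = canonical ⊥
      ; op-nonempty = λ s zs → canonical (target A s zs) , refl
      -- Membership constrains only the first coordinate, so the other two components of the
      -- equality are discarded.
      ; op-resp     = λ s xs≈ys (x₁≈y₁ , _) x∈ →
          trans (sym x₁≈y₁) (trans x∈ (target-cong s xs≈ys))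
      }
    ; dom-resp = B-mbC-resp
    ; dom⊆B    = λ z∈ → z∈
    ; 0∈dom₁   = proj₁ (canonical ⊥) , proj₂ (canonical ⊥) , refl
    ; op⊆      = λ _ _ u∈ → u∈
    }

fullSwap : BooleanAlgebra c ℓ → SwapStructure c ℓ
fullSwap A = swapStructure A (fullSwapStructure A) (fullSwapStructure-isSwapStructure A)

module _ {A A′ : BooleanAlgebra c ℓ} (f : BooleanHom A A′) where
  private
    module A = BooleanAlgebra A
  open BooleanAlgebra A′
  open BooleanHom f using (⟦_⟧; isLatticeHomomorphism; ¬-homo; ⊤-homo; ⊥-homo)
  open IsLatticeHomomorphism isLatticeHomomorphism using (⟦⟧-cong; ∧-homo; ∨-homo)

  ⁎-B-mbC : ∀ {z} → z ∈ B-mbC A → (f ⁎) z ∈ B-mbC A′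
  ⁎-B-mbC {z₁ , z₂ , z₃} (z∨ , z∧) =
      trans (sym (∨-homo z₁ z₂)) (trans (⟦⟧-cong z∨) ⊤-homo)
    , trans (∧-congˡ (sym (∧-homo z₂ z₃)))
        (trans (sym (∧-homo z₁ (z₂ A.∧ z₃))) (trans (⟦⟧-cong z∧) ⊥-homo))

  ⁎-restrict : ∃ (B-mbC A) → ∃ (B-mbC A′)
  ⁎-restrict (z , z∈) = (f ⁎) z , ⁎-B-mbC z∈

  -- This is the whole content of `preserves`: applying `f` to the equation that defines a value
  -- over `A` must give the equation that defines the corresponding value over `A′`.
  target-homo : ∀ {n} (s : Symbol n) (zs : Vec (∃ (B-mbC A)) n) →
                ⟦ target A s zs ⟧ ≈ target A′ s (map ⁎-restrict zs)
  target-homo ‵∧ (_ ∷ _ ∷ []) = ∧-homo _ _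
  target-homo ‵∨ (_ ∷ _ ∷ []) = ∨-homo _ _
  -- Implication is the term `¬ x ∨ y`, so this is the only case that needs `¬-homo`.
  target-homo ‵→ (_ ∷ _ ∷ []) = trans (∨-homo _ _) (∨-congʳ (¬-homo _))
  -- For `‵¬` and `‵∘` the target is a coordinate of the triple, not a Boolean operation, so both
  -- sides agree by computation.
  target-homo ‵¬ (_ ∷ [])     = refl
  target-homo ‵∘ (_ ∷ [])     = refl

  ⁎-hom : Category.Hom (SW-mbC c ℓ) (fullSwap A) (fullSwap A′)
  ⁎-hom = record
    { func = record
      { to   = ⁎-restrict
      ; cong = λ (p , q , r) → ⟦⟧-cong p , ⟦⟧-cong q , ⟦⟧-cong r
      }
    ; preserves = λ s zs u∈ → trans (⟦⟧-cong u∈) (target-homo s zs)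
    }

⁎-isFunctor : IsFunctor (BAlg c ℓ) (SW-mbC c ℓ) fullSwap ⁎-hom
⁎-isFunctor = record
  { cong     = λ f≈g ((z₁ , z₂ , z₃) , _) → f≈g z₁ , f≈g z₂ , f≈g z₃
  -- Both sides compute to the same triple. Their membership proofs may differ, but the setoid on
  -- the domain ignores them; the same holds for `homo`.
  ; identity = λ {A} _ → Setoid.refl (tripleSetoid A)
  ; homo     = λ {_} {_} {C} _ _ _ → Setoid.refl (tripleSetoid C)
  }

corollary6p9 : (c ℓ : Level) →
    Σ[ isSwap ∈ ((A : BooleanAlgebra c ℓ) → IsSwapStructure A (fullSwapStructure A)) ]
    let K₀ : BooleanAlgebra c ℓ → SwapStructure c ℓ
        K₀ A = swapStructure A (fullSwapStructure A) (isSwap A)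
    in
    Σ[ K₁ ∈ ({A A′ : BooleanAlgebra c ℓ} → BooleanHom A A′ → Category.Hom (SW-mbC c ℓ) (K₀ A) (K₀ A′)) ]
      (({A A′ : BooleanAlgebra c ℓ} (f : BooleanHom A A′) (z : ∃ (B-mbC A)) →
          Setoid._≈_ (tripleSetoid A′) (proj₁ (MultialgebraHom.to (K₁ f) z)) ((f ⁎) (proj₁ z)))
       × IsFunctor (BAlg c ℓ) (SW-mbC c ℓ) K₀ K₁)
corollary6p9 c ℓ =
    fullSwapStructure-isSwapStructure
  , ⁎-hom
  , (λ {_} {A′} _ _ → Setoid.refl (tripleSetoid A′))
  , ⁎-isFunctor
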